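{- Let $\mathfrak{C}=(G,X,H,f)$ be a configuration, let $v\in V(G)$ be a vertex that is not a separating vertex of $G$, and let $x_v\in X_v$ be such that $f(x_v)>0$. Let $\mathfrak{C}'=(G',X',H',f')$ be the tuple with $G'=G-v$, $X'$ the restriction of $X$ to $V(G')$, $H'=H[\bigcup_{u\in V(G')}X_u]$, and $$f'(x)=\max\{0,f(x)-\mu_H(x,x_v)\}$$ for all $x\in V(H')$. Then $\mathfrak{C}'$ is a configuration and the following statements hold: (a) If $\mathfrak{C}$ is degree-feasible, then so is $\mathfrak{C}'$. (b) If $\mathfrak{C}$ is uncolorable, then so is $\mathfrak{C}'$.
   Context: $\mathbb{N}_0=\{0,1,2,\dots\}$. Graphs are finite, undirected, may have multiple edges, no loops. $\mu_G(u,v)$ is the number of edges joining $u$ and $v$; $d_G(v)$ is the number of edges incident with $v$. A separating vertex of a connected graph is a vertex whose deletion leaves at least two components; the separating vertices of a disconnected graph are those of its components. A cover of $G$ is a pair $(X,H)$ where $H$ is a graph and $X$ assigns to each $v\in V(G)$ a set $X_v\subseteq V(H)$ such that the sets $X_v$ are pairwise disjoint, $V(H)=\bigcup_v X_v$, each $X_v$ is independent in $H$, and for distinct $u,v\in V(G)$ the set of edges of $H$ between $X_u$ and $X_v$ is the union of $\mu_G(u,v)$ (possibly empty) matchings of $H$. A transversal of $(X,H)$ is a set $T\subseteq V(H)$ with $|T\cap X_v|=1$ for all $v\in V(G)$. A configuration is a tuple $(G,X,H,f)$ where $G$ is a graph, $(X,H)$ is a cover of $G$ and $f:V(H)\to\mathbb{N}_0$.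 It is degree-feasible if $\sum_{x\in X_v}f(x)\ge d_G(v)$ for all $v\in V(G)$. A subgraph $\tilde H$ of $H$ is strictly $f$-degenerate if each non-empty subgraph $H'$ of $\tilde H$ contains a vertex $x$ with $d_{H'}(x)<f(x)$. The configuration is colorable if $(X,H)$ has a transversal $T$ such that $H[T]$ is strictly $f$-degenerate; otherwise it is uncolorable. -}

module Defs where

open import Algebra.Properties.CommutativeMonoid.Sum using (sum-syntax)
open import Data.Bool.Base using (if_then_else_)
open import Data.Fin.Base using (Fin)
open import Data.Fin.Properties using (_≟_; any?)
open import Data.Fin.Subset using (Subset; _∈_; _⊆_; _∩_; _-_; ∣_∣; Nonempty; Empty; inside)
open import Data.Fin.Subset.Properties using (_∈?_; x∈p∩q⁺)
open import Data.Nat.Base using (ℕ; _∸_; _≥_; _<_)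
open import Data.Nat.Properties using (+-0-commutativeMonoid)
open import Data.Product.Base using (_×_; _,_; proj₁; proj₂; ∃; ∃-syntax)
open import Data.Product.Properties using (≡-dec)
open import Data.Sum.Base using (_⊎_)
open import Data.Vec.Base using (tabulate)
open import Data.Vec.Properties using ([]=⇒lookup; lookup∘tabulate)
open import Function.Base using (_∘_)
open import Function.Bundles using (_⇔_)
open import Relation.Binary.Construct.Closure.ReflexiveTransitive using (Star)
open import Relation.Binary.PropositionalEquality using (_≡_; _≢_; sym; trans)
open import Relation.Nullary using (¬_; Dec; does; yes; no; _×-dec_; _⊎-dec_)
open import Relation.Unary using (Decidable)

private
  variable
    n m p q : ℕ

⟪_⟫ : {P : Fin n → Set} → Decidable P → Subset n
⟪ P? ⟫ = tabulate (does ∘ P?)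

∈⟪⟫⇒ : {P : Fin n → Set} (P? : Decidable P) {i : Fin n} → i ∈ ⟪ P? ⟫ → P i
∈⟪⟫⇒ {P = P} P? {i} i∈ =
  from (P? i) (trans (sym (lookup∘tabulate (does ∘ P?) i)) ([]=⇒lookup i∈))
  where
  from : (d : Dec (P i)) → does d ≡ inside → P i
  from (yes pi) _  = pi
  from (no  _)  ()

⋃[_]_ : Subset n → (Fin n → Subset p) → Subset p
⋃[ A ] X = ⟪ (λ x → any? (λ u → (u ∈? A) ×-dec (x ∈? X u))) ⟫

Σ[_]_ : Subset n → (Fin n → ℕ) → ℕ
Σ[_]_ {n} A f = sum-syntax +-0-commutativeMonoid n (λ x → if does (x ∈? A) then f x else 0)

-- Finite loopless multigraphs.  Vertices and edges carry names from Fin n and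
-- Fin m, and the graph consists of those names lying in V and E, so that a
-- graph and its subgraphs share names.  The order of the pair `ends e` has no
-- meaning, and `ends e` is irrelevant for e outside E.
record Graph (n m : ℕ) : Set where
  field
    V      : Subset n
    E      : Subset m
    ends   : Fin m → Fin n × Fin n
    ends∈V : ∀ {e} → e ∈ E → proj₁ (ends e) ∈ V × proj₂ (ends e) ∈ V
    noLoop : ∀ {e} → e ∈ E → proj₁ (ends e) ≢ proj₂ (ends e)

open Graph public

Joins : Graph n m → Fin m → Fin n → Fin n → Set
Joins G e u w = ends G e ≡ (u , w) ⊎ ends G e ≡ (w , u)

joins? : (G : Graph n m) (e : Fin m) (u w : Fin n) → Dec (Joins G e u w)
joins? G e u w = ≡-dec _≟_ _≟_ (ends G e) (u , w) ⊎-dec ≡-dec _≟_ _≟_ (ends G e) (w , u)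

Incident : Graph n m → Fin m → Fin n → Set
Incident G e v = proj₁ (ends G e) ≡ v ⊎ proj₂ (ends G e) ≡ v

incident? : (G : Graph n m) (e : Fin m) (v : Fin n) → Dec (Incident G e v)
incident? G e v = (proj₁ (ends G e) ≟ v) ⊎-dec (proj₂ (ends G e) ≟ v)

μ : Graph n m → Fin n → Fin n → ℕ
μ G u w = ∣ ⟪ (λ e → (e ∈? E G) ×-dec joins? G e u w) ⟫ ∣

deg : Graph n m → Fin n → ℕ
deg G v = ∣ ⟪ (λ e → (e ∈? E G) ×-dec incident? G e v) ⟫ ∣

record _≤ᴳ_ (S G : Graph n m) : Set where
  field
    V⊆    : V S ⊆ V G
    E⊆    : E S ⊆ E G
    ends≡ : ∀ {e} → e ∈ E S → ends S e ≡ ends G e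

_⟨_⟩ : Graph n m → Subset n → Graph n m
_⟨_⟩ {n} {m} G W = record
  { V      = V G ∩ W
  ; E      = ⟪ inW? ⟫
  ; ends   = ends G
  ; ends∈V = λ e∈ → let (e∈E , a∈W , b∈W) = ∈⟪⟫⇒ inW? e∈
                        (a∈V , b∈V)       = ends∈V G e∈E
                    in  x∈p∩q⁺ (a∈V , a∈W) , x∈p∩q⁺ (b∈V , b∈W)
  ; noLoop = λ e∈ → noLoop G (proj₁ (∈⟪⟫⇒ inW? e∈))
  }
  where
  inW? : Decidable (λ (e : Fin m) → e ∈ E G × proj₁ (ends G e) ∈ W × proj₂ (ends G e) ∈ W)
  inW? e = (e ∈? E G) ×-dec ((proj₁ (ends G e) ∈? W) ×-dec (proj₂ (ends G e) ∈? W))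

_∖_ : Graph n m → Fin n → Graph n m
G ∖ v = G ⟨ V G - v ⟩

Adjacent : Graph n m → Fin n → Fin n → Set
Adjacent G u w = ∃[ e ] (e ∈ E G × Joins G e u w)

Connected : Graph n m → Set
Connected G = Nonempty (V G) × (∀ {u w} → u ∈ V G → w ∈ V G → Star (Adjacent G) u w)

record IsComponent (K G : Graph n m) : Set where
  field
    subgraph  : K ≤ᴳ G
    connected : Connected K
    maximal   : ∀ (L : Graph n m) → L ≤ᴳ G → Connected L → K ≤ᴳ L → L ≤ᴳ K

-- Components are told apart by their vertex sets, because propositional
-- equality of graphs would also compare `ends` outside E.
AtLeastTwoComponents : Graph n m → Set
AtLeastTwoComponents {n} {m} G =
  ∃[ K ] ∃[ L ] (IsComponent K G × IsComponent {n} {m} L G × V K ≢ V L)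

-- A connected graph is its own only component, so this covers both the
-- connected and the disconnected case.
Separating : Graph n m → Fin n → Set
Separating {n} {m} G v =
  ∃[ K ] (IsComponent {n} {m} K G × v ∈ V K × AtLeastTwoComponents (K ∖ v))

Independent : Graph n m → Subset n → Set
Independent G A = ∀ {x y} → x ∈ A → y ∈ A → ¬ Adjacent G x y

record IsMatching (G : Graph n m) (M : Subset m) : Set where
  field
    M⊆E          : M ⊆ E G
    vertexUnique : ∀ {e e′ x} → e ∈ M → e′ ∈ M → Incident G e x → Incident G e′ x → e ≡ e′

EdgeBetween : Graph n m → Subset n → Subset n → Fin m → Set
EdgeBetween G A B e = e ∈ E G × ∃[ x ] ∃[ y ] (x ∈ A × y ∈ B × Joins G e x y)

IsUnionOfMatchings : Graph n m → (Fin m → Set) → ℕ → Set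
IsUnionOfMatchings {m = m} G F k =
  ∃ λ (M : Fin k → Subset m) →
    (∀ i → IsMatching G (M i)) × (∀ e → F e ⇔ (∃[ i ] e ∈ M i))

-- Only the values of X on V G are meaningful.
record IsCover (G : Graph n m) (X : Fin n → Subset p) (H : Graph p q) : Set where
  field
    disjoint    : ∀ {u v} → u ∈ V G → v ∈ V G → u ≢ v → Empty (X u ∩ X v)
    vertices    : V H ≡ ⋃[ V G ] X
    independent : ∀ {v} → v ∈ V G → Independent H (X v)
    matchings   : ∀ {u v} → u ∈ V G → v ∈ V G → u ≢ v →
                  IsUnionOfMatchings H (EdgeBetween H (X u) (X v)) (μ G u v)

record IsTransversal (G : Graph n m) (X : Fin n → Subset p) (H : Graph p q)
                     (T : Subset p) : Set where
  field
    T⊆V : T ⊆ V H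
    one : ∀ {v} → v ∈ V G → ∣ T ∩ X v ∣ ≡ 1

StrictlyDegenerate : Graph p q → (Fin p → ℕ) → Set
StrictlyDegenerate {p} {q} H f =
  ∀ (S : Graph p q) → S ≤ᴳ H → Nonempty (V S) → ∃[ x ] (x ∈ V S × deg S x < f x)

-- Only the values of X on V G, and of f on V H, are meaningful; hence
-- restricting X and f to subgraphs leaves these functions unchanged.
record Tuple (n m p q : ℕ) : Set where
  constructor ⟨_,_,_,_⟩
  field
    G : Graph n m
    X : Fin n → Subset p
    H : Graph p q
    f : Fin p → ℕ

IsConfiguration : Tuple n m p q → Set
IsConfiguration ⟨ G , X , H , f ⟩ = IsCover G X H

DegreeFeasible : Tuple n m p q → Set
DegreeFeasible ⟨ G , X , H , f ⟩ = ∀ {v} → v ∈ V G → Σ[ X v ] f ≥ deg G v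

Colorable : Tuple n m p q → Set
Colorable ⟨ G , X , H , f ⟩ =
  ∃[ T ] (IsTransversal G X H T × StrictlyDegenerate (H ⟨ T ⟩) f)

Uncolorable : Tuple n m p q → Set
Uncolorable C = ¬ Colorable C

-- Truncated subtraction on ℕ is max {0 , f x - μ H x xᵥ}.
reduce : Tuple n m p q → Fin n → Fin p → Tuple n m p q
reduce ⟨ G , X , H , f ⟩ v xᵥ =
  ⟨ G ∖ v , X , H ⟨ ⋃[ V (G ∖ v) ] X ⟩ , (λ x → f x ∸ μ H x xᵥ) ⟩

{-# OPTIONS --safe #-}
module Submission where

-- Colour v with xᵥ first.  For (a), passing to G ∖ v costs u exactly μ G u v
-- edges, while each of the μ G u v matchings between X u and X v has at most
-- one edge at xᵥ, so the values of f on X u drop by at most μ G u v in total.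
-- For (b), add xᵥ to a transversal of the reduced cover.  A subgraph S with a
-- vertex besides xᵥ has a low-degree vertex x in S ∖ xᵥ, and putting xᵥ back
-- raises its degree by at most μ H x xᵥ, the amount subtracted from f x; if xᵥ
-- is the only vertex of S, its degree is 0.

open import Defs
open import Data.Empty using (⊥-elim)
open import Data.Fin.Base using (Fin; zero; suc)
open import Data.Fin.Properties using (_≟_; any?; 0≢1+n; suc-injective; ¬Fin0)
open import Data.Fin.Subset using (Subset; _∈_; _∉_; _⊆_; _∩_; _∪_; _─_; _-_; ⁅_⁆; ∣_∣; Empty; inside; outside)
open import Data.Fin.Subset.Properties using (_∈?_; nonempty?; Empty-unique; ∣⊥∣≡0; ∣⁅x⁆∣≡1; x∈⁅x⁆; x∈⁅y⁆⇒x≡y; ⊆-antisym; p⊆q⇒∣p∣≤∣q∣; x∈p∩q⁺; x∈p∩q⁻; p∩q⊆p; p∩q⊆q; x∈p∪q⁺; x∈p∪q⁻; p─q⊆p; x∈p∧x∉q⇒x∈p─q; x∈p∧x≢y⇒x∈p-y)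
open import Data.Nat.Base using (ℕ; zero; suc; _+_; _∸_; _≤_; _<_; _>_; z≤n; s≤s)
open import Data.Nat.Properties using (+-suc; +-identityʳ; +-mono-≤; +-monoʳ-≤; +-cancelʳ-≤; m≤n+m∸n; ≤-trans; ≤-reflexive; ≤-<-trans; module ≤-Reasoning)
open import Data.Nat.Solver using (module +-*-Solver)
open import Data.Product.Base using (_×_; _,_; proj₁; proj₂; ∃-syntax)
open import Data.Sum.Base using (_⊎_; inj₁; inj₂)
open import Data.Vec.Base using ([]; _∷_; here; there)
open import Data.Vec.Properties using (lookup⇒[]=; lookup∘tabulate)
open import Function.Base using (_∘_)
open import Function.Bundles using (mk⇔; module Equivalence)
open import Relation.Binary.PropositionalEquality using (_≡_; _≢_; refl; sym; trans; cong; subst)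
open import Relation.Nullary using (¬_; does; yes; no; contradiction; _×-dec_)
open import Relation.Nullary.Decidable using (dec-true)
open import Relation.Unary using (Decidable)

private
  variable
    n m p q k : ℕ

-- Truncated subtraction, and membership and counting in finite subsets.

m<n∸o⇒m+o<n : ∀ m n o → m < n ∸ o → m + o < n
m<n∸o⇒m+o<n m n       zero    m<n = subst (_< n) (sym (+-identityʳ m)) m<n
m<n∸o⇒m+o<n m (suc n) (suc o) m<  = subst (_< suc n) (sym (+-suc m o)) (s≤s (m<n∸o⇒m+o<n m n o m<))

⇒∈⟪⟫ : {P : Fin n → Set} (P? : Decidable P) {i : Fin n} → P i → i ∈ ⟪ P? ⟫
⇒∈⟪⟫ P? {i} pi =
  lookup⇒[]= i _ (trans (lookup∘tabulate (does ∘ P?) i) (dec-true (P? i) pi))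

∈⋃⁺ : {A : Subset n} {X : Fin n → Subset p} {u : Fin n} {x : Fin p} →
      u ∈ A → x ∈ X u → x ∈ ⋃[ A ] X
∈⋃⁺ {A = A} {X} u∈A x∈X =
  ⇒∈⟪⟫ (λ x → any? (λ u → (u ∈? A) ×-dec (x ∈? X u))) (_ , u∈A , x∈X)

∈⋃⁻ : (A : Subset n) (X : Fin n → Subset p) {x : Fin p} →
      x ∈ ⋃[ A ] X → ∃[ u ] (u ∈ A × x ∈ X u)
∈⋃⁻ A X = ∈⟪⟫⇒ (λ x → any? (λ u → (u ∈? A) ×-dec (x ∈? X u)))

x∈p─q⇒x∉q : (p q : Subset n) {x : Fin n} → x ∈ p ─ q → x ∉ q
x∈p─q⇒x∉q (_ ∷ p) (_ ∷ q) (there x∈) (there x∈q) = x∈p─q⇒x∉q p q x∈ x∈q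
x∈p─q⇒x∉q (inside  ∷ p) (inside ∷ q) () here
x∈p─q⇒x∉q (outside ∷ p) (inside ∷ q) () here

x∈p-y⇒x≢y : {p : Subset n} {x y : Fin n} → x ∈ p - y → x ≢ y
x∈p-y⇒x≢y {p = p} {y = y} x∈ refl = x∈p─q⇒x∉q p ⁅ y ⁆ x∈ (x∈⁅x⁆ y)

-- The two cardinality bounds that follow, and the induction over matchings, all split `r` in this
-- way.
∣r∩p∣+∣r─p∣≡∣r∣ : (r p : Subset n) → ∣ r ∩ p ∣ + ∣ r ─ p ∣ ≡ ∣ r ∣
∣r∩p∣+∣r─p∣≡∣r∣ [] [] = refl
∣r∩p∣+∣r─p∣≡∣r∣ (inside ∷ r) (inside ∷ p) = cong suc (∣r∩p∣+∣r─p∣≡∣r∣ r p)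
∣r∩p∣+∣r─p∣≡∣r∣ (inside ∷ r) (outside ∷ p) =
  trans (+-suc ∣ r ∩ p ∣ ∣ r ─ p ∣) (cong suc (∣r∩p∣+∣r─p∣≡∣r∣ r p))
∣r∩p∣+∣r─p∣≡∣r∣ (outside ∷ r) (inside ∷ p) = ∣r∩p∣+∣r─p∣≡∣r∣ r p
∣r∩p∣+∣r─p∣≡∣r∣ (outside ∷ r) (outside ∷ p) = ∣r∩p∣+∣r─p∣≡∣r∣ r p

-- `p` fits into `r ∩ p`, and `q`, which avoids `p`, fits into `r ─ p`.
disjoint⇒∣p∣+∣q∣≤∣r∣ : {p q r : Subset n} → p ⊆ r → q ⊆ r →
                       (∀ {x} → x ∈ q → x ∉ p) → ∣ p ∣ + ∣ q ∣ ≤ ∣ r ∣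
disjoint⇒∣p∣+∣q∣≤∣r∣ {p = p} {q} {r} p⊆r q⊆r dis =
  subst (∣ p ∣ + ∣ q ∣ ≤_) (∣r∩p∣+∣r─p∣≡∣r∣ r p)
    (+-mono-≤ (p⊆q⇒∣p∣≤∣q∣ (λ x∈p → x∈p∩q⁺ (p⊆r x∈p , x∈p)))
              (p⊆q⇒∣p∣≤∣q∣ (λ x∈q → x∈p∧x∉q⇒x∈p─q (q⊆r x∈q) (dis x∈q))))

cover⇒∣r∣≤∣p∣+∣q∣ : {p q r : Subset n} → (∀ {x} → x ∈ r → x ∉ p → x ∈ q) →
                    ∣ r ∣ ≤ ∣ p ∣ + ∣ q ∣
cover⇒∣r∣≤∣p∣+∣q∣ {p = p} {q} {r} cov =
  subst (_≤ ∣ p ∣ + ∣ q ∣) (∣r∩p∣+∣r─p∣≡∣r∣ r p)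
    (+-mono-≤ (p⊆q⇒∣p∣≤∣q∣ (p∩q⊆q r p))
              (p⊆q⇒∣p∣≤∣q∣ (λ x∈ → cov (p─q⊆p r p x∈) (x∈p─q⇒x∉q r p x∈))))

Empty⇒∣p∣≡0 : {p : Subset n} → Empty p → ∣ p ∣ ≡ 0
Empty⇒∣p∣≡0 {n} empty = trans (cong ∣_∣ (Empty-unique empty)) (∣⊥∣≡0 n)

subsingleton⇒∣p∣≤1 : {p : Subset n} → (∀ {x y} → x ∈ p → y ∈ p → x ≡ y) → ∣ p ∣ ≤ 1
subsingleton⇒∣p∣≤1 {p = p} uniq with nonempty? p
... | yes (x , x∈p) = subst (∣ p ∣ ≤_) (∣⁅x⁆∣≡1 x)
  (p⊆q⇒∣p∣≤∣q∣ (λ y∈p → subst (_∈ ⁅ x ⁆) (uniq x∈p y∈p) (x∈⁅x⁆ x)))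
... | no empty = subst (_≤ 1) (sym (Empty⇒∣p∣≡0 empty)) z≤n

-- Induction on `k`: the part of `r` inside `M zero` has at most one element, and the rest is
-- covered by the other `k` sets. It is applied to the edges at one vertex, with matchings as the
-- covering sets.
covered-by-k⇒∣r∣≤k : {r : Subset n} (M : Fin k → Subset n) →
                     (∀ i {x y} → x ∈ r → y ∈ r → x ∈ M i → y ∈ M i → x ≡ y) →
                     (∀ {x} → x ∈ r → ∃[ i ] x ∈ M i) → ∣ r ∣ ≤ k
covered-by-k⇒∣r∣≤k {k = zero} M uniq cov =
  ≤-reflexive (Empty⇒∣p∣≡0 (λ (x , x∈r) → ¬Fin0 (proj₁ (cov x∈r))))
covered-by-k⇒∣r∣≤k {k = suc k} {r = r} M uniq cov =
  subst (_≤ suc k) (∣r∩p∣+∣r─p∣≡∣r∣ r (M zero))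
    (+-mono-≤ (subsingleton⇒∣p∣≤1 λ x∈ y∈ →
                 let (x∈r , x∈M) = x∈p∩q⁻ r _ x∈
                     (y∈r , y∈M) = x∈p∩q⁻ r _ y∈
                 in  uniq zero x∈r y∈r x∈M y∈M)
              (covered-by-k⇒∣r∣≤k (M ∘ suc)
                 (λ i x∈ y∈ → uniq (suc i) (p─q⊆p r _ x∈) (p─q⊆p r _ y∈))
                 -- Outside `M zero` the covering index is a successor, so it can be shifted down.
                 (λ x∈ → tail-index (x∈p─q⇒x∉q r _ x∈) (cov (p─q⊆p r _ x∈)))))
  where
  tail-index : ∀ {x} → x ∉ M zero → ∃[ i ] x ∈ M i → ∃[ i ] x ∈ M (suc i)
  tail-index x∉ (zero  , x∈) = contradiction x∈ x∉
  tail-index x∉ (suc i , x∈) = i , x∈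

-- Induction along `A`: once `N zero` has been taken out of `r`, what is left still contains the
-- remaining sets.
Σ∣disjoint∣≤∣r∣ : (A : Subset n) (N : Fin n → Subset q) (r : Subset q) →
                  (∀ {i j e} → i ∈ A → j ∈ A → e ∈ N i → e ∈ N j → i ≡ j) →
                  (∀ {i} → i ∈ A → N i ⊆ r) → Σ[ A ] (∣_∣ ∘ N) ≤ ∣ r ∣
Σ∣disjoint∣≤∣r∣ [] N r dis sub = z≤n
Σ∣disjoint∣≤∣r∣ (outside ∷ A) N r dis sub =
  Σ∣disjoint∣≤∣r∣ A (N ∘ suc) r
    (λ i∈ j∈ e∈ e∈′ → suc-injective (dis (there i∈) (there j∈) e∈ e∈′)) (sub ∘ there)
Σ∣disjoint∣≤∣r∣ (inside ∷ A) N r dis sub = begin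
  ∣ N zero ∣ + Σ[ A ] (∣_∣ ∘ N ∘ suc)  ≤⟨ +-monoʳ-≤ ∣ N zero ∣ ih ⟩
  ∣ N zero ∣ + ∣ r ─ N zero ∣          ≤⟨ disjoint⇒∣p∣+∣q∣≤∣r∣ (sub here) (p─q⊆p r (N zero)) (x∈p─q⇒x∉q r (N zero)) ⟩
  ∣ r ∣                                ∎
  where
  open ≤-Reasoning
  ih = Σ∣disjoint∣≤∣r∣ A (N ∘ suc) (r ─ N zero)
    (λ i∈ j∈ e∈ e∈′ → suc-injective (dis (there i∈) (there j∈) e∈ e∈′))
    -- An element shared with `N zero` would identify the index `zero` with a successor.
    (λ i∈ e∈ → x∈p∧x∉q⇒x∈p─q (sub (there i∈) e∈) λ e∈₀ → 0≢1+n (dis here (there i∈) e∈₀ e∈))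

-- Termwise `f x ≤ g x + (f x ∸ g x)`; equality fails exactly where `g x` exceeds `f x` and the
-- subtraction is truncated.
Σf≤Σ[f∸g]+Σg : (A : Subset n) (f g : Fin n → ℕ) →
               Σ[ A ] f ≤ Σ[ A ] (λ x → f x ∸ g x) + Σ[ A ] g
Σf≤Σ[f∸g]+Σg [] f g = z≤n
Σf≤Σ[f∸g]+Σg (outside ∷ A) f g = Σf≤Σ[f∸g]+Σg A (f ∘ suc) (g ∘ suc)
Σf≤Σ[f∸g]+Σg (inside ∷ A) f g = begin
  f₀ + Σ[ A ] (f ∘ suc)              ≤⟨ +-mono-≤ (m≤n+m∸n f₀ g₀) (Σf≤Σ[f∸g]+Σg A (f ∘ suc) (g ∘ suc)) ⟩
  (g₀ + (f₀ ∸ g₀)) + (s + t)         ≡⟨ solve 4 (λ a b c d → (a :+ b) :+ (c :+ d) := (b :+ c) :+ (a :+ d)) refl g₀ (f₀ ∸ g₀) s t ⟩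
  (f₀ ∸ g₀ + s) + (g₀ + t)           ∎
  where
  open ≤-Reasoning
  open +-*-Solver
  f₀ = f zero
  g₀ = g zero
  s = Σ[ A ] (λ x → f (suc x) ∸ g (suc x))
  t = Σ[ A ] (g ∘ suc)

-- Induced subgraphs, and the effect of vertex deletion on multiplicities and degrees.

∈E⟨⟩⁺ : (G : Graph n m) (W : Subset n) {e : Fin m} →
        e ∈ E G → proj₁ (ends G e) ∈ W → proj₂ (ends G e) ∈ W → e ∈ E (G ⟨ W ⟩)
∈E⟨⟩⁺ G W e∈ a∈ b∈ =
  ⇒∈⟪⟫ (λ e → (e ∈? E G) ×-dec ((proj₁ (ends G e) ∈? W) ×-dec (proj₂ (ends G e) ∈? W)))
       (e∈ , a∈ , b∈)

∈E⟨⟩⁻ : (G : Graph n m) (W : Subset n) {e : Fin m} → e ∈ E (G ⟨ W ⟩) →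
        e ∈ E G × proj₁ (ends G e) ∈ W × proj₂ (ends G e) ∈ W
∈E⟨⟩⁻ G W =
  ∈⟪⟫⇒ (λ e → (e ∈? E G) ×-dec ((proj₁ (ends G e) ∈? W) ×-dec (proj₂ (ends G e) ∈? W)))

∈V∖⁺ : (G : Graph n m) {u v : Fin n} → u ∈ V G → u ≢ v → u ∈ V (G ∖ v)
∈V∖⁺ G u∈ u≢v = x∈p∩q⁺ (u∈ , x∈p∧x≢y⇒x∈p-y u∈ u≢v)

∈V∖⁻ : (G : Graph n m) {u v : Fin n} → u ∈ V (G ∖ v) → u ∈ V G × u ≢ v
∈V∖⁻ G u∈ = let (u∈V , u∈-) = x∈p∩q⁻ (V G) _ u∈ in u∈V , x∈p-y⇒x≢y u∈-

∈E∖⁺ : (G : Graph n m) {v : Fin n} {e : Fin m} →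
       e ∈ E G → ¬ Incident G e v → e ∈ E (G ∖ v)
∈E∖⁺ G {v} e∈ ¬inc = let (a∈ , b∈) = ends∈V G e∈ in
  ∈E⟨⟩⁺ G (V G - v) e∈ (x∈p∧x≢y⇒x∈p-y a∈ (¬inc ∘ inj₁)) (x∈p∧x≢y⇒x∈p-y b∈ (¬inc ∘ inj₂))

∈E∖⁻ : (G : Graph n m) {v : Fin n} {e : Fin m} →
       e ∈ E (G ∖ v) → e ∈ E G × ¬ Incident G e v
∈E∖⁻ G {v} e∈ = let (e∈E , a∈ , b∈) = ∈E⟨⟩⁻ G (V G - v) e∈ in
  e∈E , λ { (inj₁ a≡v) → x∈p-y⇒x≢y a∈ a≡v ; (inj₂ b≡v) → x∈p-y⇒x≢y b∈ b≡v }

joins⇒incidentˡ : (G : Graph n m) {e : Fin m} {u w : Fin n} → Joins G e u w → Incident G e u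
joins⇒incidentˡ G (inj₁ eq) = inj₁ (cong proj₁ eq)
joins⇒incidentˡ G (inj₂ eq) = inj₂ (cong proj₂ eq)

joins⇒incidentʳ : (G : Graph n m) {e : Fin m} {u w : Fin n} → Joins G e u w → Incident G e w
joins⇒incidentʳ G (inj₁ eq) = inj₂ (cong proj₂ eq)
joins⇒incidentʳ G (inj₂ eq) = inj₁ (cong proj₁ eq)

incident⇒joins : (G : Graph n m) {e : Fin m} {u w : Fin n} → u ≢ w →
                 Incident G e u → Incident G e w → Joins G e u w
incident⇒joins G u≢w (inj₁ refl) (inj₁ refl) = contradiction refl u≢w
incident⇒joins G u≢w (inj₁ refl) (inj₂ refl) = inj₁ refl
incident⇒joins G u≢w (inj₂ refl) (inj₁ refl) = inj₂ refl
incident⇒joins G u≢w (inj₂ refl) (inj₂ refl) = contradiction refl u≢w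

incident-joins⇒endpoint : (G : Graph n m) {e : Fin m} {u w z : Fin n} →
                          Joins G e u w → Incident G e z → z ≡ u ⊎ z ≡ w
incident-joins⇒endpoint G (inj₁ eq) (inj₁ refl) = inj₁ (cong proj₁ eq)
incident-joins⇒endpoint G (inj₁ eq) (inj₂ refl) = inj₂ (cong proj₂ eq)
incident-joins⇒endpoint G (inj₂ eq) (inj₁ refl) = inj₂ (cong proj₁ eq)
incident-joins⇒endpoint G (inj₂ eq) (inj₂ refl) = inj₁ (cong proj₂ eq)

joins-injectiveˡ : (G : Graph n m) {e : Fin m} {u w z : Fin n} →
                   Joins G e u z → Joins G e w z → u ≡ w
joins-injectiveˡ G (inj₁ p) (inj₁ q) = cong proj₁ (trans (sym p) q)
-- Here `(u , z)` equals `(z , w)`, so `u` and `w` both equal `z`.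
joins-injectiveˡ G (inj₁ p) (inj₂ q) = let r = trans (sym p) q in trans (cong proj₁ r) (cong proj₂ r)
joins-injectiveˡ G (inj₂ p) (inj₁ q) = let r = trans (sym p) q in trans (cong proj₂ r) (cong proj₁ r)
joins-injectiveˡ G (inj₂ p) (inj₂ q) = cong proj₂ (trans (sym p) q)

-- `μ G u w` is by definition the cardinality of this set, as `deg G v` is that of `edgesAt G v`, so
-- the bounds on subsets apply to both directly.
joinedBy : Graph n m → Fin n → Fin n → Subset m
joinedBy G u w = ⟪ (λ e → (e ∈? E G) ×-dec joins? G e u w) ⟫

∈joinedBy⁻ : (G : Graph n m) {u w : Fin n} {e : Fin m} →
             e ∈ joinedBy G u w → e ∈ E G × Joins G e u w
∈joinedBy⁻ G {u} {w} = ∈⟪⟫⇒ (λ e → (e ∈? E G) ×-dec joins? G e u w)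

∈joinedBy⁺ : (G : Graph n m) {u w : Fin n} {e : Fin m} →
             e ∈ E G → Joins G e u w → e ∈ joinedBy G u w
∈joinedBy⁺ G {u} {w} e∈ j = ⇒∈⟪⟫ (λ e → (e ∈? E G) ×-dec joins? G e u w) (e∈ , j)

edgesAt : Graph n m → Fin n → Subset m
edgesAt G v = ⟪ (λ e → (e ∈? E G) ×-dec incident? G e v) ⟫

∈edgesAt⁻ : (G : Graph n m) {v : Fin n} {e : Fin m} →
            e ∈ edgesAt G v → e ∈ E G × Incident G e v
∈edgesAt⁻ G {v} = ∈⟪⟫⇒ (λ e → (e ∈? E G) ×-dec incident? G e v)

∈edgesAt⁺ : (G : Graph n m) {v : Fin n} {e : Fin m} →
            e ∈ E G → Incident G e v → e ∈ edgesAt G v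
∈edgesAt⁺ G {v} e∈ i = ⇒∈⟪⟫ (λ e → (e ∈? E G) ×-dec incident? G e v) (e∈ , i)

-- An edge joining `u` and `w` meets no third vertex, so it survives the deletion of `v`.
μ-∖ : (G : Graph n m) {u v w : Fin n} → u ≢ v → w ≢ v → μ G u w ≡ μ (G ∖ v) u w
μ-∖ G {u} {v} {w} u≢v w≢v = cong ∣_∣ (⊆-antisym to from)
  where
  to : joinedBy G u w ⊆ joinedBy (G ∖ v) u w
  to e∈ = let (e∈E , j) = ∈joinedBy⁻ G e∈ in
    ∈joinedBy⁺ (G ∖ v) (∈E∖⁺ G e∈E λ inc → case (incident-joins⇒endpoint G j inc)) j
    where
    case : ¬ (v ≡ u ⊎ v ≡ w)
    case (inj₁ v≡u) = u≢v (sym v≡u)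
    case (inj₂ v≡w) = w≢v (sym v≡w)
  from : joinedBy (G ∖ v) u w ⊆ joinedBy G u w
  from e∈ = let (e∈E , j) = ∈joinedBy⁻ (G ∖ v) e∈ in ∈joinedBy⁺ G (proj₁ (∈E∖⁻ G e∈E)) j

-- Edges at `u` that survive the deletion avoid `v`, while those joining `u` and `v` meet it, so no
-- edge at `u` is counted twice.
deg-∖+μ≤deg : (G : Graph n m) (u v : Fin n) → deg (G ∖ v) u + μ G u v ≤ deg G u
deg-∖+μ≤deg G u v = disjoint⇒∣p∣+∣q∣≤∣r∣ {p = edgesAt (G ∖ v) u} {joinedBy G u v} {edgesAt G u}
  (λ e∈ → let (e∈E , i) = ∈edgesAt⁻ (G ∖ v) e∈ in ∈edgesAt⁺ G (proj₁ (∈E∖⁻ G e∈E)) i)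
  (λ e∈ → let (e∈E , j) = ∈joinedBy⁻ G e∈ in ∈edgesAt⁺ G e∈E (joins⇒incidentˡ G j))
  (λ e∈ e∈′ → proj₂ (∈E∖⁻ G (proj₁ (∈edgesAt⁻ (G ∖ v) e∈′)))
                    (joins⇒incidentʳ G (proj₂ (∈joinedBy⁻ G e∈))))

≤ᴳ-joins : {S G : Graph n m} → S ≤ᴳ G → {e : Fin m} {u w : Fin n} →
           e ∈ E S → Joins S e u w → Joins G e u w
≤ᴳ-joins S≤G e∈ (inj₁ eq) = inj₁ (trans (sym (_≤ᴳ_.ends≡ S≤G e∈)) eq)
≤ᴳ-joins S≤G e∈ (inj₂ eq) = inj₂ (trans (sym (_≤ᴳ_.ends≡ S≤G e∈)) eq)

-- An edge of `S` at `u` that is lost with `v` joins `u` and `v`. It is counted in `G` rather than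
-- in `S` because the reduced `f` subtracts multiplicities of the ambient graph.
deg≤deg-∖+μ : {S G : Graph n m} → S ≤ᴳ G → {u v : Fin n} → u ≢ v →
              deg S u ≤ deg (S ∖ v) u + μ G u v
deg≤deg-∖+μ {S = S} {G} S≤G {u} {v} u≢v =
  cover⇒∣r∣≤∣p∣+∣q∣ {p = edgesAt (S ∖ v) u} {joinedBy G u v} {edgesAt S u} cov
  where
  cov : ∀ {e} → e ∈ edgesAt S u → e ∉ edgesAt (S ∖ v) u → e ∈ joinedBy G u v
  cov {e} e∈ e∉ with ∈edgesAt⁻ S e∈ | incident? S e v
  ... | e∈S , i | yes j = ∈joinedBy⁺ G (_≤ᴳ_.E⊆ S≤G e∈S)
                            (≤ᴳ-joins S≤G e∈S (incident⇒joins S u≢v i j))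
  ... | e∈S , i | no ¬j = contradiction (∈edgesAt⁺ (S ∖ v) (∈E∖⁺ S e∈S ¬j) i) e∉

-- Both ends of an edge of `S` would equal `v`, making it a loop.
deg-lonely : (S : Graph n m) {v : Fin n} → (∀ {u} → u ∈ V S → u ≡ v) → deg S v ≡ 0
deg-lonely S lonely = Empty⇒∣p∣≡0 λ (e , e∈) →
  let e∈S       = proj₁ (∈edgesAt⁻ S e∈)
      (a∈ , b∈) = ends∈V S e∈S
  in  noLoop S e∈S (trans (lonely a∈) (sym (lonely b∈)))

-- The sum counts the edges joining `y` to `A`, and each of the `k` matchings contains at most one
-- edge at `y`.
Σμ≤k : (H : Graph p q) {A B : Subset p} {y : Fin p} → y ∈ B →
       IsUnionOfMatchings H (EdgeBetween H A B) k → Σ[ A ] (λ x → μ H x y) ≤ k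
Σμ≤k H {A} {B} {y} y∈B (M , matching , F⇔M) = ≤-trans
  (Σ∣disjoint∣≤∣r∣ A N (⋃[ A ] N)
    -- An edge with `y` as one end determines its other end, so the sets `N x` are disjoint.
    (λ _ _ e∈ e∈′ → joins-injectiveˡ H (proj₂ (∈joinedBy⁻ H e∈)) (proj₂ (∈joinedBy⁻ H e∈′)))
    (λ i∈A → ∈⋃⁺ {X = N} i∈A))
  (covered-by-k⇒∣r∣≤k M
    (λ i e∈ e∈′ e∈M e∈M′ →
       IsMatching.vertexUnique (matching i) e∈M e∈M′ (at-y e∈) (at-y e∈′))
    (λ e∈ → let (x , x∈A , e∈N) = ∈⋃⁻ A N e∈
                (e∈E , j)       = ∈joinedBy⁻ H e∈N
            in  Equivalence.to (F⇔M _) (e∈E , x , y , x∈A , y∈B , j)))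
  where
  N : _ → _
  N x = joinedBy H x y
  at-y : ∀ {e} → e ∈ ⋃[ A ] N → Incident H e y
  at-y e∈ = let (x , _ , e∈N) = ∈⋃⁻ A N e∈ in joins⇒incidentʳ H (proj₂ (∈joinedBy⁻ H e∈N))

-- The reduced configuration: its cover, its degree-feasibility, and the extension of its colorings.

module Reduction (G : Graph n m) (X : Fin n → Subset p) (H : Graph p q) (f : Fin p → ℕ)
                 (cover : IsCover G X H) {v : Fin n} (v∈G : v ∈ V G)
                 {xᵥ : Fin p} (xᵥ∈X : xᵥ ∈ X v) where

  open IsCover cover

  G′ : Graph n m
  G′ = G ∖ v

  W : Subset p
  W = ⋃[ V G′ ] X

  H′ : Graph p q
  H′ = H ⟨ W ⟩

  X⊆V : ∀ {u x} → u ∈ V G → x ∈ X u → x ∈ V H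
  X⊆V u∈ x∈ = subst (_ ∈_) (sym vertices) (∈⋃⁺ {X = X} u∈ x∈)

  edgeBetween⇒∈E′ : ∀ {u w e} → u ∈ V G′ → w ∈ V G′ →
                    EdgeBetween H (X u) (X w) e → e ∈ E H′
  edgeBetween⇒∈E′ u∈ w∈ (e∈ , x , y , x∈ , y∈ , inj₁ eq) = ∈E⟨⟩⁺ H W e∈
    (subst (_∈ W) (sym (cong proj₁ eq)) (∈⋃⁺ {X = X} u∈ x∈))
    (subst (_∈ W) (sym (cong proj₂ eq)) (∈⋃⁺ {X = X} w∈ y∈))
  edgeBetween⇒∈E′ u∈ w∈ (e∈ , x , y , x∈ , y∈ , inj₂ eq) = ∈E⟨⟩⁺ H W e∈
    (subst (_∈ W) (sym (cong proj₁ eq)) (∈⋃⁺ {X = X} w∈ y∈))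
    (subst (_∈ W) (sym (cong proj₂ eq)) (∈⋃⁺ {X = X} u∈ x∈))

  -- The original matchings serve again: an edge of `H` between `X u` and `X w` with `u` and `w` in
  -- `G′` has both ends in `W`, so it stays in `H′`.
  isCover′ : IsCover G′ X H′
  isCover′ = record
    { disjoint    = λ u∈ w∈ → disjoint (proj₁ (∈V∖⁻ G u∈)) (proj₁ (∈V∖⁻ G w∈))
    ; vertices    = ⊆-antisym (p∩q⊆q (V H) W)
        (λ x∈W → let (u , u∈ , x∈X) = ∈⋃⁻ (V G′) X x∈W
                 in  x∈p∩q⁺ (X⊆V (proj₁ (∈V∖⁻ G u∈)) x∈X , x∈W))
    ; independent = λ u∈ x∈ y∈ (e , e∈ , j) →
        independent (proj₁ (∈V∖⁻ G u∈)) x∈ y∈ (e , proj₁ (∈E⟨⟩⁻ H W e∈) , j)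
    ; matchings   = matchings′
    }
    where
    matchings′ : ∀ {u w} → u ∈ V G′ → w ∈ V G′ → u ≢ w →
                 IsUnionOfMatchings H′ (EdgeBetween H′ (X u) (X w)) (μ G′ u w)
    matchings′ {u} {w} u∈ w∈ u≢w
      with (u∈G , u≢v) ← ∈V∖⁻ G u∈ | (w∈G , w≢v) ← ∈V∖⁻ G w∈
      with (M , matching , F⇔M) ← matchings u∈G w∈G u≢w =
      -- The family `M` is indexed by `μ G u w`, which is rewritten to `μ G′ u w`.
      subst (IsUnionOfMatchings H′ (EdgeBetween H′ (X u) (X w))) (μ-∖ G u≢v w≢v)
        ( M
        , (λ i → record
            { M⊆E          = λ e∈ → edgeBetween⇒∈E′ u∈ w∈ (Equivalence.from (F⇔M _) (i , e∈))
            ; vertexUnique = IsMatching.vertexUnique (matching i)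
            })
        , (λ e → mk⇔
            (λ (e∈ , between) → Equivalence.to (F⇔M e) (proj₁ (∈E⟨⟩⁻ H W e∈) , between))
            (λ e∈M → let between = Equivalence.from (F⇔M e) e∈M
                     in  edgeBetween⇒∈E′ u∈ w∈ between , proj₂ between)))

  degreeFeasible′ : DegreeFeasible (⟨ G , X , H , f ⟩) →
                    DegreeFeasible (reduce (⟨ G , X , H , f ⟩) v xᵥ)
  degreeFeasible′ feasible {u} u∈ with (u∈G , u≢v) ← ∈V∖⁻ G u∈ =
    -- Both sides are raised by `μ G u v`: the degree of `u` falls by at least this amount, the sum
    -- over `X u` by at most this amount.
    +-cancelʳ-≤ (μ G u v) (deg G′ u) _ (begin
      deg G′ u + μ G u v                          ≤⟨ deg-∖+μ≤deg G u v ⟩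
      deg G u                                     ≤⟨ feasible u∈G ⟩
      Σ[ X u ] f                                  ≤⟨ Σf≤Σ[f∸g]+Σg (X u) f μᵥ ⟩
      Σ[ X u ] (λ x → f x ∸ μᵥ x) + Σ[ X u ] μᵥ   ≤⟨ +-monoʳ-≤ _ (Σμ≤k H xᵥ∈X (matchings u∈G v∈G u≢v)) ⟩
      Σ[ X u ] (λ x → f x ∸ μᵥ x) + μ G u v       ∎)
    where
    open ≤-Reasoning
    μᵥ : Fin p → ℕ
    μᵥ x = μ H x xᵥ

  -- `T` lies above `G′` and `xᵥ` above `v`. By disjointness of the cover, `T` misses `X v`, and
  -- `xᵥ` adds nothing to any other `X u`.
  isTransversal : {T : Subset p} → IsTransversal G′ X H′ T → IsTransversal G X H (T ∪ ⁅ xᵥ ⁆)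
  isTransversal {T} trans′ = record { T⊆V = T⊆V″ ; one = one″ }
    where
    open IsTransversal trans′
    T⊆V″ : T ∪ ⁅ xᵥ ⁆ ⊆ V H
    T⊆V″ x∈ with x∈p∪q⁻ T ⁅ xᵥ ⁆ x∈
    ... | inj₁ x∈T = p∩q⊆p (V H) W (T⊆V x∈T)
    ... | inj₂ x∈₁ = subst (_∈ V H) (sym (x∈⁅y⁆⇒x≡y xᵥ x∈₁)) (X⊆V v∈G xᵥ∈X)

    T∩Xᵥ : ∀ {x} → x ∈ T → x ∉ X v
    T∩Xᵥ x∈T x∈X with (u , u∈ , x∈Xᵤ) ← ∈⋃⁻ (V G′) X (p∩q⊆q (V H) W (T⊆V x∈T))
                 with (u∈G , u≢v) ← ∈V∖⁻ G u∈ =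
      disjoint u∈G v∈G u≢v (_ , x∈p∩q⁺ (x∈Xᵤ , x∈X))

    one-v : (T ∪ ⁅ xᵥ ⁆) ∩ X v ⊆ ⁅ xᵥ ⁆
    one-v x∈ with (x∈∪ , x∈X) ← x∈p∩q⁻ (T ∪ ⁅ xᵥ ⁆) (X v) x∈ with x∈p∪q⁻ T ⁅ xᵥ ⁆ x∈∪
    ... | inj₁ x∈T = contradiction x∈X (T∩Xᵥ x∈T)
    ... | inj₂ x∈₁ = x∈₁

    one-u : ∀ {u} → u ∈ V G → u ≢ v → (T ∪ ⁅ xᵥ ⁆) ∩ X u ⊆ T ∩ X u
    one-u {u} u∈ u≢v x∈ with (x∈∪ , x∈X) ← x∈p∩q⁻ (T ∪ ⁅ xᵥ ⁆) (X u) x∈ with x∈p∪q⁻ T ⁅ xᵥ ⁆ x∈∪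
    ... | inj₁ x∈T = x∈p∩q⁺ (x∈T , x∈X)
    ... | inj₂ x∈₁ with refl ← x∈⁅y⁆⇒x≡y xᵥ x∈₁ =
      ⊥-elim (disjoint u∈ v∈G u≢v (_ , x∈p∩q⁺ (x∈X , xᵥ∈X)))

    one″ : ∀ {u} → u ∈ V G → ∣ (T ∪ ⁅ xᵥ ⁆) ∩ X u ∣ ≡ 1
    one″ {u} u∈ with u ≟ v
    ... | yes refl = trans (cong ∣_∣ (⊆-antisym one-v ⊇)) (∣⁅x⁆∣≡1 xᵥ)
      where
      ⊇ : ⁅ xᵥ ⁆ ⊆ (T ∪ ⁅ xᵥ ⁆) ∩ X v
      ⊇ x∈₁ = x∈p∩q⁺ (x∈p∪q⁺ (inj₂ x∈₁) , subst (_∈ X v) (sym (x∈⁅y⁆⇒x≡y xᵥ x∈₁)) xᵥ∈X)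
    ... | no u≢v = trans (cong ∣_∣ (⊆-antisym (one-u u∈ u≢v) ⊇)) (one (∈V∖⁺ G u∈ u≢v))
      where
      ⊇ : T ∩ X u ⊆ (T ∪ ⁅ xᵥ ⁆) ∩ X u
      ⊇ x∈ = let (x∈T , x∈X) = x∈p∩q⁻ T (X u) x∈ in x∈p∩q⁺ (x∈p∪q⁺ (inj₁ x∈T) , x∈X)

  strictlyDegenerate : {T : Subset p} → f xᵥ > 0 → T ⊆ V H′ →
                       StrictlyDegenerate (H′ ⟨ T ⟩) (λ x → f x ∸ μ H x xᵥ) →
                       StrictlyDegenerate (H ⟨ T ∪ ⁅ xᵥ ⁆ ⟩) f
  strictlyDegenerate {T} f>0 T⊆V degen S S≤ (z , z∈S) with nonempty? (V (S ∖ xᵥ))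
  -- `S` is non-empty, so `xᵥ` is its only vertex and has degree 0, below the positive `f xᵥ`.
  ... | no empty = xᵥ , subst (_∈ V S) (lonely z∈S) z∈S
                      , subst (_< f xᵥ) (sym (deg-lonely S lonely)) f>0
    where
    lonely : ∀ {u} → u ∈ V S → u ≡ xᵥ
    lonely {u} u∈ with u ≟ xᵥ
    ... | yes u≡ = u≡
    ... | no u≢ = contradiction (u , ∈V∖⁺ S u∈ u≢) empty
  ... | yes nonempty = restore (degen (S ∖ xᵥ) S∖≤ nonempty)
    where
    open _≤ᴳ_ S≤
    T⁺ : Subset p
    T⁺ = T ∪ ⁅ xᵥ ⁆

    S≤H : S ≤ᴳ H
    S≤H = record
      { V⊆    = λ u∈ → p∩q⊆p (V H) T⁺ (V⊆ u∈)
      ; E⊆    = λ e∈ → proj₁ (∈E⟨⟩⁻ H T⁺ (E⊆ e∈))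
      ; ends≡ = ends≡
      }

    V∖⊆T : ∀ {u} → u ∈ V (S ∖ xᵥ) → u ∈ T
    V∖⊆T u∈ with (u∈S , u≢) ← ∈V∖⁻ S u∈ with x∈p∪q⁻ T ⁅ xᵥ ⁆ (p∩q⊆q (V H) T⁺ (V⊆ u∈S))
    ... | inj₁ u∈T = u∈T
    ... | inj₂ u∈₁ = contradiction (x∈⁅y⁆⇒x≡y xᵥ u∈₁) u≢

    S∖≤ : (S ∖ xᵥ) ≤ᴳ (H′ ⟨ T ⟩)
    S∖≤ = record
      { V⊆    = λ u∈ → x∈p∩q⁺ (T⊆V (V∖⊆T u∈) , V∖⊆T u∈)
      ; E⊆    = λ {e} e∈ →
          let e∈S       = proj₁ (∈E∖⁻ S e∈)
              (a∈ , b∈) = ends∈V (S ∖ xᵥ) e∈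
              -- Edges of an induced subgraph are selected by the ends in `H`, so membership is
              -- carried over from the ends in `S`.
              a∈T       = subst (_∈ T) (cong proj₁ (ends≡ e∈S)) (V∖⊆T a∈)
              b∈T       = subst (_∈ T) (cong proj₂ (ends≡ e∈S)) (V∖⊆T b∈)
              e∈H       = proj₁ (∈E⟨⟩⁻ H T⁺ (E⊆ e∈S))
              W∋        = λ {x} (x∈T : x ∈ T) → p∩q⊆q (V H) W (T⊆V x∈T)
          in  ∈E⟨⟩⁺ H′ T (∈E⟨⟩⁺ H W e∈H (W∋ a∈T) (W∋ b∈T)) a∈T b∈T
      ; ends≡ = λ e∈ → ends≡ (proj₁ (∈E∖⁻ S e∈))
      }

    restore : ∃[ x ] (x ∈ V (S ∖ xᵥ) × deg (S ∖ xᵥ) x < f x ∸ μ H x xᵥ) →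
              ∃[ x ] (x ∈ V S × deg S x < f x)
    restore (x , x∈ , deg<) = let (x∈S , x≢) = ∈V∖⁻ S x∈ in
      -- A number strictly below `f x ∸ μ H x xᵥ` shows that nothing was truncated, so adding
      -- `μ H x xᵥ` back stays below `f x`.
      x , x∈S , ≤-<-trans (deg≤deg-∖+μ S≤H x≢)
                          (m<n∸o⇒m+o<n (deg (S ∖ xᵥ) x) (f x) (μ H x xᵥ) deg<)

proposition12 : ∀ {n m p q : ℕ} (G : Graph n m) (X : Fin n → Subset p) (H : Graph p q) (f : Fin p → ℕ) →
    let C = ⟨ G , X , H , f ⟩ in
    IsConfiguration C →
    (v : Fin n) → v ∈ V G → ¬ Separating G v →
    (xᵥ : Fin p) → xᵥ ∈ X v → f xᵥ > 0 →
    let C′ = reduce C v xᵥ in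
    IsConfiguration C′
    × (DegreeFeasible C → DegreeFeasible C′)
    × (Uncolorable C → Uncolorable C′)
proposition12 G X H f cover v v∈G _ xᵥ xᵥ∈X f>0 =
    isCover′
  , degreeFeasible′
  -- By contraposition: a coloring of the reduced configuration extends by `xᵥ`.
  , λ uncolorable (T , trans′ , degen) →
      uncolorable ( T ∪ ⁅ xᵥ ⁆ , isTransversal trans′
                  , strictlyDegenerate f>0 (IsTransversal.T⊆V trans′) degen )
  where open Reduction G X H f cover v∈G xᵥ∈X
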